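{- Let $r,c,k$ be positive integers with $r$ even, let $\lambda=[(kc)^r,((k-1)c)^r,\ldots,c^r]$ be the generalized staircase, and let $i,j\ge0$ be integers with $\lambda[i,j]\neq[\,]$. Then $\lambda[i,j]$ is a $\mathcal P$-position (losing position) of the game King under normal play if and only if $$i\left(c\left(k-\left\lfloor \frac{i}{r}\right\rfloor\right)-j\right)$$ is odd.
   Context: A partition is a finite weakly decreasing sequence $\lambda=[\lambda_1,\ldots,\lambda_s]$ of positive integers (exponents denote repetition of parts; $[\,]$ is the empty partition). For $i,j\ge 0$, $\lambda[i,j]=[\lambda_{i+1}-j,\lambda_{i+2}-j,\ldots]$ with trailing nonpositive entries removed. King is the two-player impartial game whose positions are nonempty partitions; from $\mu$ a player may move to $\mu[a,b]$ for any $(a,b)\in\{(0,1),(1,0),(1,1)\}$ with $\mu[a,b]\ne[\,]$. Normal play: the player who cannot move loses. A position is a $\mathcal P$-position if no move from it leads to a $\mathcal P$-position (in particular terminal positions are $\mathcal P$); otherwise it is an $\mathcal N$-position. -}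

module Defs where

open import Data.Bool.Base using (true; false)
open import Data.Empty using (⊥-elim-irr)
open import Data.Integer.Base as ℤ using (ℤ; +_; 1ℤ)
open import Data.List.Base using (List; []; _∷_; _++_; map; filter; drop; replicate; sum)
open import Data.List.Membership.Propositional using (_∈_)
open import Data.List.Relation.Unary.All as All using (All; []; _∷_)
import Data.List.Relation.Unary.All.Properties as All
open import Data.List.Relation.Unary.AllPairs using (AllPairs; []; _∷_)
import Data.List.Relation.Unary.AllPairs.Properties as AllPairs
open import Data.List.Relation.Unary.Any using (here; there)
open import Data.List.Relation.Unary.Linked as Linked using (Linked; []; [-]; _∷_)
import Data.List.Relation.Unary.Linked.Properties as Linked
open import Data.Nat.Base
open import Data.Nat.Induction using (<-wellFounded)
open import Data.Nat.Properties
open import Data.Product.Base using (∃; _×_; _,_)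
open import Function.Base using (_∘_; flip)
open import Function.Bundles using (_⇔_; mk⇔)
open import Induction.WellFounded using (Acc; acc; WellFounded; module Subrelation)
import Relation.Binary.Construct.On as On
open import Relation.Binary.PropositionalEquality using (_≡_; _≢_; refl)
open import Relation.Nullary.Negation.Core using (¬_)
open import Relation.Nullary.Decidable.Core using (recompute)

-- The proof fields are irrelevant, so a partition is determined by its parts.
record Partition : Set where
  constructor mkPartition
  field
    parts       : List ℕ
    .decreasing : Linked _≥_ parts
    .positive   : All (0 <_) parts

open Partition public using (parts)

∅ : Partition
∅ = mkPartition [] [] []

-- `m ∸ j` is 0 exactly when the integer m - j is nonpositive, and in a
-- weakly decreasing sequence such entries are all trailing, so filtering
-- them out removes precisely the trailing nonpositive entries.
cutParts : ℕ → ℕ → List ℕ → List ℕ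
cutParts i j xs = filter (0 <?_) (map (_∸ j) (drop i xs))

private
  drop-decreasing : ∀ i {xs} → Linked _≥_ xs → Linked _≥_ (drop i xs)
  drop-decreasing zero             l = l
  drop-decreasing (suc i) {[]}     l = l
  drop-decreasing (suc i) {x ∷ xs} l = drop-decreasing i (Linked.tail l)

  cut-decreasing : ∀ i j {xs} → Linked _≥_ xs → Linked _≥_ (cutParts i j xs)
  cut-decreasing i j l =
    Linked.filter⁺ (0 <?_) (flip ≤-trans)
      (Linked.map⁺ (Linked.map (∸-monoˡ-≤ j) (drop-decreasing i l)))

infix 9 _[_,_]

_[_,_] : Partition → ℕ → ℕ → Partition
mkPartition xs dec _ [ i , j ] =
  mkPartition (cutParts i j xs) (cut-decreasing i j dec)
              (All.all-filter (0 <?_) (map (_∸ j) (drop i xs)))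

staircaseParts : (r c k : ℕ) → List ℕ
staircaseParts r c zero    = []
staircaseParts r c (suc k) = replicate r (suc k * c) ++ staircaseParts r c k

private
  staircase-bound : ∀ r c k → All (_≤ k * c) (staircaseParts r c k)
  staircase-bound r c zero    = []
  staircase-bound r c (suc k) =
    All.++⁺ (All.replicate⁺ r ≤-refl)
            (All.map (λ p → ≤-trans p (m≤n+m (k * c) c)) (staircase-bound r c k))

  replicate-pairs : ∀ n x → AllPairs _≥_ (replicate n x)
  replicate-pairs zero    x = []
  replicate-pairs (suc n) x = All.replicate⁺ n ≤-refl ∷ replicate-pairs n x

  staircase-pairs : ∀ r c k → AllPairs _≥_ (staircaseParts r c k)
  staircase-pairs r c zero    = []
  staircase-pairs r c (suc k) =
    AllPairs.++⁺ (replicate-pairs r (suc k * c)) (staircase-pairs r c k)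
      (All.replicate⁺ r
        (All.map (λ p → ≤-trans p (m≤n+m (k * c) c)) (staircase-bound r c k)))

  staircase-positive : ∀ r c k → .{{NonZero c}} → All (0 <_) (staircaseParts r c k)
  staircase-positive r c zero    = []
  staircase-positive r c (suc k) =
    All.++⁺ (All.replicate⁺ r (≤-trans (>-nonZero⁻¹ c) (m≤m+n c (k * c))))
            (staircase-positive r c k)

-- [(kc)^r, ((k-1)c)^r, …, c^r]
staircase : (r c k : ℕ) → .{{NonZero c}} → Partition
staircase r c k = record
  { parts      = staircaseParts r c k
  ; decreasing = Linked.AllPairs⇒Linked (staircase-pairs r c k)
  ; positive   = staircase-positive r c k
  }

record Position : Set where
  constructor position
  field
    partition : Partition
    .nonempty : partition ≢ ∅

open Position public using (partition)

kingSteps : List (ℕ × ℕ)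
kingSteps = (0 , 1) ∷ (1 , 0) ∷ (1 , 1) ∷ []

infix 4 _⟶_

data _⟶_ (μ : Position) : Position → Set where
  move : ∀ {a b} → (a , b) ∈ kingSteps →
         .(ne : partition μ [ a , b ] ≢ ∅) →
         μ ⟶ position (partition μ [ a , b ]) ne

private
  size : Position → ℕ
  size = sum ∘ parts ∘ partition

  cut-≤ : ∀ b xs → sum (filter (0 <?_) (map (_∸ b) xs)) ≤ sum xs
  cut-≤ b []       = z≤n
  cut-≤ b (x ∷ xs) with 0 <ᵇ x ∸ b
  ... | true  = +-mono-≤ (m∸n≤m x b) (cut-≤ b xs)
  ... | false = ≤-trans (cut-≤ b xs) (m≤n+m (sum xs) x)

  cut-< : ∀ x xs → 0 < x → sum (cutParts 0 1 (x ∷ xs)) < sum (x ∷ xs)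
  cut-< (suc x) xs _ with 0 <ᵇ x
  ... | true  = s≤s (+-monoʳ-≤ x (cut-≤ 1 xs))
  ... | false = s≤s (≤-trans (cut-≤ 1 xs) (m≤n+m (sum xs) x))

  drop-< : ∀ b x xs → 0 < x → sum (cutParts 1 b (x ∷ xs)) < sum (x ∷ xs)
  drop-< b x xs 0<x = +-mono-<-≤ 0<x (cut-≤ b xs)

  move-< : ∀ {μ ν} → μ ⟶ ν → size ν < size μ
  move-< {position (mkPartition [] _ _) ne} (move _ _) = ⊥-elim-irr (ne refl)
  move-< {position (mkPartition (x ∷ xs) _ pos) _} (move (here refl) _) =
    cut-< x xs (recompute (0 <? x) (All.head pos))
  move-< {position (mkPartition (x ∷ xs) _ pos) _} (move (there (here refl)) _) =
    drop-< 0 x xs (recompute (0 <? x) (All.head pos))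
  move-< {position (mkPartition (x ∷ xs) _ pos) _} (move (there (there (here refl))) _) =
    drop-< 1 x xs (recompute (0 <? x) (All.head pos))

⟶-wellFounded : WellFounded (flip _⟶_)
⟶-wellFounded = Subrelation.wellFounded move-< (On.wellFounded size <-wellFounded)

-- The defining condition "no move leads to a P-position" has a negative
-- recursive occurrence, so it is read as a recursion along moves, which
-- terminates because each move decreases the sum of the parts.
IsPAcc : ∀ μ → Acc (flip _⟶_) μ → Set
IsPAcc μ (acc rs) = ∀ ν (m : μ ⟶ ν) → ¬ IsPAcc ν (rs m)

IsP : Position → Set
IsP μ = IsPAcc μ (⟶-wellFounded μ)

private
  IsPAcc-irr : ∀ {μ} (p q : Acc (flip _⟶_) μ) → IsPAcc μ p → IsPAcc μ q
  IsPAcc-irr (acc rs) (acc rs′) h ν m isP = h ν m (IsPAcc-irr (rs′ m) (rs m) isP)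

  IsPAcc-unfold : ∀ μ (p : Acc (flip _⟶_) μ) →
                  IsPAcc μ p ⇔ (∀ ν → μ ⟶ ν → ¬ IsP ν)
  IsPAcc-unfold μ (acc rs) = mk⇔
    (λ h ν m isP → h ν m (IsPAcc-irr (⟶-wellFounded ν) (rs m) isP))
    (λ h ν m isP → h ν m (IsPAcc-irr (rs m) (⟶-wellFounded ν) isP))

IsP-unfold : ∀ μ → IsP μ ⇔ (∀ ν → μ ⟶ ν → ¬ IsP ν)
IsP-unfold μ = IsPAcc-unfold μ (⟶-wellFounded μ)

Odd : ℤ → Set
Odd z = ∃ λ m → z ≡ + 2 ℤ.* m ℤ.+ 1ℤ

{-# OPTIONS --safe #-}
-- Put h i = λ_{i+1}, which equals c (k - ⌊i / r⌋) for the staircase. The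
-- position λ[i,j] is nonempty iff j < h i, and the options of λ[i,j] are the
-- nonempty λ[i + a, j + b]. If i and h i - j are both odd, every option makes
-- one of them even. Otherwise some option makes both odd: if i is odd, remove a
-- column; if i is even, then h (i + 1) = h i because r is even, so remove a row,
-- together with a column when h i - j is even.
module Submission where

open import Defs
open import Data.Integer.Base using (+_; _*_; _-_)
open import Data.Nat.Base using (ℕ; NonZero; _/_)
open import Data.Nat.Divisibility.Core using (_∣_)
open import Function.Bundles using (_⇔_)
open import Relation.Binary.PropositionalEquality using (_≢_)

open import Data.Bool.Base using (true; false)
open import Data.Empty.Irrelevant using (⊥-elim)
import Data.Integer.Base as ℤ
import Data.Integer.Properties as ℤ
open import Data.List.Base using (List; []; _∷_; _++_; map; filter; drop; replicate)
open import Data.List.Membership.Propositional using (_∈_)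
open import Data.List.Properties using (filter-accept; filter-none; map-∘; map-cong; drop-map; drop-drop)
open import Data.List.Relation.Unary.All as All using (All; []; _∷_)
import Data.List.Relation.Unary.All.Properties as All
open import Data.List.Relation.Unary.AllPairs as AllPairs using (AllPairs; []; _∷_)
import Data.List.Relation.Unary.AllPairs.Properties as AllPairs
open import Data.List.Relation.Unary.Any using (here; there)
open import Data.List.Relation.Unary.Linked using (linked?)
open import Data.List.Relation.Unary.Linked.Properties using (Linked⇒AllPairs)
open import Data.Nat.Base as ℕ using (zero; suc; _+_; _∸_; _≤_; _<_; _≥_; z≤n; s≤s; s<s; s≤s⁻¹; s<s⁻¹; parity)
open import Data.Nat.Divisibility.Core using (divides)
open import Data.Nat.DivMod using (m<n⇒m/n≡0; m/n≡1+[m∸n]/n)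
open import Data.Nat.Properties
open import Data.Parity.Base as ℙ using (0ℙ; 1ℙ)
import Data.Parity.Properties as ℙ
open import Data.Product.Base using (∃₂; _×_; _,_)
open import Data.Sum.Base using (inj₁; inj₂)
open import Function.Base using (flip; _∘_)
open import Function.Bundles using (mk⇔; Equivalence)
open import Induction.WellFounded using (Acc; acc)
open import Relation.Binary.PropositionalEquality using (_≡_; refl; sym; trans; cong; subst; module ≡-Reasoning)
open import Relation.Nullary.Decidable.Core using (Dec; yes; no; recompute; decidable-stable)
open import Relation.Nullary.Decidable using (_×-dec_)
open import Relation.Nullary.Negation.Core using (¬_; contradiction)

open Equivalence using (to; from)

private
  variable
    i j a b r : ℕ
    xs ys : List ℕ

-- Indices start at 0, and the value past the end is 0.
part : List ℕ → ℕ → ℕ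
part []       _       = 0
part (x ∷ xs) zero    = x
part (x ∷ xs) (suc i) = part xs i

parts-injective : ∀ {μ ν} → parts μ ≡ parts ν → μ ≡ ν
parts-injective {mkPartition _ _ _} {mkPartition _ _ _} refl = refl

parts-decreasing : ∀ μ → AllPairs _≥_ (parts μ)
parts-decreasing (mkPartition xs dec _) =
  -- `dec` is irrelevant; deciding `Linked` recovers a proof that relevant code may use.
  Linked⇒AllPairs (flip ≤-trans) (recompute (linked? _≥?_ xs) dec)

-- The inner filter discards only zeros. These stay zero under `_∸ b`, so the outer filter would
-- discard them anyway.
filter-map-∸-filter : ∀ b xs →
  filter (0 <?_) (map (_∸ b) (filter (0 <?_) xs)) ≡ filter (0 <?_) (map (_∸ b) xs)
filter-map-∸-filter b []           = refl
filter-map-∸-filter b (zero ∷ xs)  rewrite 0∸n≡0 b = filter-map-∸-filter b xs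
filter-map-∸-filter b (suc x ∷ xs) with 0 ℕ.<ᵇ suc x ∸ b
... | true  = cong (suc x ∸ b ∷_) (filter-map-∸-filter b xs)
... | false = filter-map-∸-filter b xs

filter-positive-none : All (_≤ 0) xs → filter (0 <?_) xs ≡ []
filter-positive-none = filter-none (0 <?_) ∘ All.map ≤⇒≯

-- In a weakly decreasing list the zeros form a suffix, so the filter truncates the list and leaves
-- the indices of the surviving entries unchanged.
drop-filter : ∀ a → AllPairs _≥_ xs → drop a (filter (0 <?_) xs) ≡ filter (0 <?_) (drop a xs)
drop-filter zero    _  = refl
drop-filter (suc a) [] = refl
drop-filter {zero ∷ xs}  (suc a) (0≥ ∷ _)
  rewrite filter-positive-none 0≥ = sym (filter-positive-none (All.drop⁺ a 0≥))
drop-filter {suc x ∷ xs} (suc a) (_ ∷ dec) = drop-filter a dec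

-- This puts the game on coordinates: every option of a cut of a partition is again a cut of the
-- same partition.
cut-cut : ∀ i j a b → AllPairs _≥_ xs →
          cutParts a b (cutParts i j xs) ≡ cutParts (a + i) (b + j) xs
cut-cut {xs} i j a b dec = begin
  F (map (_∸ b) (drop a (F (map (_∸ j) (drop i xs)))))
    ≡⟨ cong (F ∘ map (_∸ b)) (drop-filter a (AllPairs.map⁺ (AllPairs-map-∸ (AllPairs.drop⁺ i dec)))) ⟩
  F (map (_∸ b) (F (drop a (map (_∸ j) (drop i xs)))))
    ≡⟨ filter-map-∸-filter b (drop a (map (_∸ j) (drop i xs))) ⟩
  F (map (_∸ b) (drop a (map (_∸ j) (drop i xs))))
    ≡⟨ cong (F ∘ map (_∸ b)) (drop-map a (drop i xs)) ⟩
  F (map (_∸ b) (map (_∸ j) (drop a (drop i xs))))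
    ≡⟨ cong F (map-∘ {g = _∸ b} {f = _∸ j} (drop a (drop i xs))) ⟨
  F (map (λ x → x ∸ j ∸ b) (drop a (drop i xs)))
    ≡⟨ cong F (map-cong (λ x → trans (∸-+-assoc x j b) (cong (x ∸_) (+-comm j b))) (drop a (drop i xs))) ⟩
  F (map (_∸ (b + j)) (drop a (drop i xs)))
    ≡⟨ cong (F ∘ map (_∸ (b + j))) (trans (drop-drop i a xs) (cong (flip drop xs) (+-comm i a))) ⟩
  F (map (_∸ (b + j)) (drop (a + i) xs)) ∎
  where
  open ≡-Reasoning
  F = filter (0 <?_)
  AllPairs-map-∸ : ∀ {ys} → AllPairs _≥_ ys → AllPairs (λ x y → x ∸ j ≥ y ∸ j) ys
  AllPairs-map-∸ = AllPairs.map (∸-monoˡ-≤ j)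

cut-empty : ∀ i → AllPairs _≥_ xs → part xs i ≤ j → cutParts i j xs ≡ []
cut-empty zero    []        _   = refl
cut-empty (suc i) []        _   = refl
cut-empty zero    (x≥ ∷ _)  x≤j = filter-positive-none
  (All.map⁺ (All.map (≤-reflexive ∘ m≤n⇒m∸n≡0) (x≤j ∷ All.map (flip ≤-trans x≤j) x≥)))
cut-empty (suc i) (_ ∷ dec) p   = cut-empty i dec p

cut-nonempty : ∀ xs i → j < part xs i → cutParts i j xs ≢ []
cut-nonempty {j} (x ∷ xs) zero j<x eq
  with () ← trans (sym eq) (filter-accept (0 <?_) {xs = map (_∸ j) xs} (m<n⇒0<n∸m j<x))
cut-nonempty (x ∷ xs) (suc i) p = cut-nonempty xs i p

[,]-nonempty : ∀ μ i → j < part (parts μ) i → μ [ i , j ] ≢ ∅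
[,]-nonempty μ i p = cut-nonempty (parts μ) i p ∘ cong parts

[,]-nonempty⁻¹ : ∀ μ i j → .(μ [ i , j ] ≢ ∅) → j < part (parts μ) i
-- As `ne` is irrelevant, it can serve only to refute: the inequality is decided, and `ne` excludes
-- the negative answer.
[,]-nonempty⁻¹ μ i j ne with j <? part (parts μ) i
... | yes p = p
... | no ¬p = ⊥-elim (ne (parts-injective (cut-empty i (parts-decreasing μ) (≮⇒≥ ¬p))))

-- This is the form in which the evenness of the block length enters the game analysis.
Paired : List ℕ → Set
Paired xs = ∀ i → parity i ≡ 0ℙ → part xs (suc i) ≡ part xs i

parity-suc : ∀ n → parity (suc n) ≡ parity n ℙ.⁻¹
parity-suc n = trans (sym (ℙ.⁻¹-involutive _)) (cong ℙ._⁻¹ (ℙ.suc-homo-⁻¹ n))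

-- The bound `j < a` keeps truncation away, so the difference drops by exactly one.
parity-∸-suc : j < a → parity (a ∸ suc j) ≡ parity (a ∸ j) ℙ.⁻¹
parity-∸-suc {j} {suc a} (s≤s j≤a) =
  sym (trans (cong (ℙ._⁻¹ ∘ parity) (+-∸-assoc 1 j≤a)) (ℙ.suc-homo-⁻¹ (a ∸ j)))

-- A positive even difference is at least 2, so one more column can be removed without emptying the
-- row.
even-∸⇒suc< : ∀ m j → j < m → parity (m ∸ j) ≡ 0ℙ → suc j < m
even-∸⇒suc< (suc (suc m)) zero    _   _ = s≤s (s≤s z≤n)
even-∸⇒suc< (suc m)       (suc j) j<m e = s<s (even-∸⇒suc< m j (s<s⁻¹ j<m) e)

module _ (μ : Partition) (paired : Paired (parts μ)) where

  private
    h : ℕ → ℕ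
    h = part (parts μ)

    OddPair : ℕ → ℕ → Set
    OddPair i j = parity i ≡ 1ℙ × parity (h i ∸ j) ≡ 1ℙ

  no-move-between-odd-pairs : (a , b) ∈ kingSteps → j < h i → OddPair i j → ¬ OddPair (a + i) (b + j)
  no-move-between-odd-pairs (here refl) j<h (_ , d-odd) (_ , d′-odd)
    with () ← trans (sym d′-odd) (trans (parity-∸-suc j<h) (cong ℙ._⁻¹ d-odd))
  no-move-between-odd-pairs {i = i} (there (here refl)) _ (i-odd , _) (i′-odd , _)
    with () ← trans (sym i′-odd) (trans (parity-suc i) (cong ℙ._⁻¹ i-odd))
  no-move-between-odd-pairs {i = i} (there (there (here refl))) _ (i-odd , _) (i′-odd , _)
    with () ← trans (sym i′-odd) (trans (parity-suc i) (cong ℙ._⁻¹ i-odd))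

  move-to-odd-pair : ∀ i j → j < h i → ¬ OddPair i j →
    ∃₂ λ a b → (a , b) ∈ kingSteps × b + j < h (a + i) × OddPair (a + i) (b + j)
  move-to-odd-pair i j j<h ¬odd with parity i in eqi | parity (h i ∸ j) in eqd
  ... | 1ℙ | 1ℙ = contradiction (refl , refl) ¬odd
  ... | 1ℙ | 0ℙ = 0 , 1 , here refl , even-∸⇒suc< (h i) j j<h eqd
                , eqi , trans (parity-∸-suc j<h) (cong ℙ._⁻¹ eqd)
  -- `paired` carries both the bound and the parity from row `i` over to row `suc i`.
  ... | 0ℙ | 1ℙ = 1 , 0 , there (here refl) , subst (j <_) (sym (paired i eqi)) j<h
                , trans (parity-suc i) (cong ℙ._⁻¹ eqi)
                , trans (cong (λ x → parity (x ∸ j)) (paired i eqi)) eqd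
  ... | 0ℙ | 0ℙ = 1 , 1 , there (there (here refl))
                , subst (suc j <_) (sym (paired i eqi)) (even-∸⇒suc< (h i) j j<h eqd)
                , trans (parity-suc i) (cong ℙ._⁻¹ eqi)
                , trans (cong (λ x → parity (x ∸ suc j)) (paired i eqi))
                        (trans (parity-∸-suc j<h) (cong ℙ._⁻¹ eqd))

  [,]-[,] : ∀ i j a b → μ [ i , j ] [ a , b ] ≡ μ [ a + i , b + j ]
  [,]-[,] i j a b = parts-injective (cut-cut i j a b (parts-decreasing μ))

  -- Induction along moves. The position `ν` is tied to `μ [ i , j ]` by an equation because a move
  -- yields `μ [ i , j ] [ a , b ]`, which is only propositionally equal to the cut at `a + i` and
  -- `b + j`.
  IsP⇔OddPair : ∀ i j ν → Acc (flip _⟶_) ν → partition ν ≡ μ [ i , j ] → IsP ν ⇔ OddPair i j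
  IsP⇔OddPair i j ν@(position _ ne) (acc rs) refl = mk⇔ IsP⇒OddPair OddPair⇒IsP
    where
    j<h : j < h i
    j<h = [,]-nonempty⁻¹ μ i j ne

    OddPair? : Dec (OddPair i j)
    OddPair? = (parity i ℙ.≟ 1ℙ) ×-dec (parity (h i ∸ j) ℙ.≟ 1ℙ)

    IsP⇒OddPair : IsP ν → OddPair i j
    -- A P-position refutes only the failure of `OddPair`, since that failure yields a move to a
    -- P-position; decidability removes the double negation.
    IsP⇒OddPair isP = decidable-stable OddPair? λ ¬odd →
      let a , b , step , b+j<h , odd = move-to-odd-pair i j j<h ¬odd
          m = move step (subst (_≢ ∅) (sym ([,]-[,] i j a b)) ([,]-nonempty μ (a + i) b+j<h))
      in to (IsP-unfold ν) isP _ m (from (IsP⇔OddPair (a + i) (b + j) _ (rs m) ([,]-[,] i j a b)) odd)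

    OddPair⇒IsP : OddPair i j → IsP ν
    OddPair⇒IsP odd = from (IsP-unfold ν) λ where
      _ m@(move {a} {b} step _) isP → no-move-between-odd-pairs step j<h odd
        (to (IsP⇔OddPair (a + i) (b + j) _ (rs m) ([,]-[,] i j a b)) isP)

-- A block of even length is used up by whole pairs of rows, so `ys` starts at an even index; the
-- recursion peels off two copies at a time.
Paired-replicate-++ : 2 ∣ r → ∀ x → Paired ys → Paired (replicate r x ++ ys)
Paired-replicate-++ (divides zero    refl) x paired = paired
Paired-replicate-++ (divides (suc q) refl) x paired zero          _ = refl
Paired-replicate-++ (divides (suc q) refl) x paired (suc (suc i)) e =
  Paired-replicate-++ (divides q refl) x paired i e

staircase-Paired : ∀ c k → 2 ∣ r → Paired (staircaseParts r c k)
staircase-Paired c zero    _   _ _ = refl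
staircase-Paired c (suc k) 2∣r = Paired-replicate-++ 2∣r (suc k ℕ.* c) (staircase-Paired c k 2∣r)

part-replicate-++-< : ∀ {x} → i < r → part (replicate r x ++ ys) i ≡ x
part-replicate-++-< {zero}  {suc r} _   = refl
part-replicate-++-< {suc i} {suc r} i<r = part-replicate-++-< (s<s⁻¹ i<r)

part-replicate-++-≥ : ∀ {x} → i ≥ r → part (replicate r x ++ ys) i ≡ part ys (i ∸ r)
part-replicate-++-≥ {r = zero}          _   = refl
part-replicate-++-≥ {suc i} {r = suc r} i≥r = part-replicate-++-≥ (s≤s⁻¹ i≥r)

-- Passing one block lowers both `k` and `i / r` by one. Beyond the last block the truncated
-- `k ∸ i / r` is 0, in agreement with the default value of `part`.
staircase-part : ∀ r c k .{{_ : NonZero r}} i →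
                 part (staircaseParts r c k) i ≡ (k ∸ i / r) ℕ.* c
staircase-part r c zero    i = cong (ℕ._* c) (sym (0∸n≡0 (i / r)))
staircase-part r c (suc k) i with <-≤-connex i r
... | inj₁ i<r = begin
  part (replicate r (suc k ℕ.* c) ++ _) i ≡⟨ part-replicate-++-< i<r ⟩
  suc k ℕ.* c                             ≡⟨ cong (λ q → (suc k ∸ q) ℕ.* c) (m<n⇒m/n≡0 i<r) ⟨
  (suc k ∸ i / r) ℕ.* c                   ∎
  where open ≡-Reasoning
... | inj₂ r≤i = begin
  part (replicate r (suc k ℕ.* c) ++ _) i ≡⟨ part-replicate-++-≥ r≤i ⟩
  part (staircaseParts r c k) (i ∸ r)     ≡⟨ staircase-part r c k (i ∸ r) ⟩
  (k ∸ (i ∸ r) / r) ℕ.* c                 ≡⟨ cong (λ q → (suc k ∸ q) ℕ.* c) (m/n≡1+[m∸n]/n r≤i) ⟨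
  (suc k ∸ i / r) ℕ.* c                   ∎
  where open ≡-Reasoning

parity-odd⇒Odd : ∀ n → parity n ≡ 1ℙ → Odd (+ n)
parity-odd⇒Odd (suc zero)    _ = + 0 , refl
parity-odd⇒Odd (suc (suc n)) e with m , eq ← parity-odd⇒Odd n e = ℤ.suc m , (begin
  + 2 ℤ.+ + n                      ≡⟨ cong (λ z → + 2 ℤ.+ z) eq ⟩
  + 2 ℤ.+ (+ 2 * m ℤ.+ ℤ.1ℤ)       ≡⟨ ℤ.+-assoc (+ 2) (+ 2 * m) ℤ.1ℤ ⟨
  + 2 ℤ.+ + 2 * m ℤ.+ ℤ.1ℤ         ≡⟨ cong (ℤ._+ ℤ.1ℤ) (ℤ.*-distribˡ-+ (+ 2) ℤ.1ℤ m) ⟨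
  + 2 * ℤ.suc m ℤ.+ ℤ.1ℤ           ∎)
  where open ≡-Reasoning

Odd⇒parity-odd : ∀ n → Odd (+ n) → parity n ≡ 1ℙ
Odd⇒parity-odd n (+ m , eq)
  rewrite ℤ.+-injective (trans eq (cong (ℤ._+ ℤ.1ℤ) (sym (ℤ.pos-* 2 m))))
        | ℙ.+-homo-+ (2 ℕ.* m) 1 | ℙ.*-homo-* 2 m = refl
-- Rewriting by `+-suc` exposes a successor, so that twice the negative witness plus one computes to
-- a negative integer, which `+ n` cannot equal.
Odd⇒parity-odd n (ℤ.-[1+ m ] , eq) rewrite +-suc m (m + 0) with () ← eq

parity-*-odd : ∀ m n → parity (m ℕ.* n) ≡ 1ℙ ⇔ (parity m ≡ 1ℙ × parity n ≡ 1ℙ)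
parity-*-odd m n rewrite ℙ.*-homo-* m n with parity m | parity n
... | 0ℙ | _ = mk⇔ (λ ()) (λ ())
... | 1ℙ | _ = mk⇔ (refl ,_) (λ (_ , e) → e)

+-∸ : ∀ {m n} → n ≤ m → + m - + n ≡ + (m ∸ n)
+-∸ {m} {n} n≤m = trans (ℤ.m-n≡m⊖n m n) (ℤ.⊖-≥ n≤m)

corollary3p12 : (r c k : ℕ) → .{{_ : NonZero r}} → .{{_ : NonZero c}} → .{{_ : NonZero k}} →
    2 ∣ r →
    (i j : ℕ) →
    (ne : staircase r c k [ i , j ] ≢ ∅) →
    IsP (position (staircase r c k [ i , j ]) ne)
    ⇔ Odd (+ i * (+ c * (+ k - + (i / r)) - + j))
corollary3p12 r c k 2∣r i j ne = mk⇔
  (λ isP → subst Odd (sym value) (parity-odd⇒Odd _ (from (parity-*-odd i d) (to IsP⇔ isP))))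
  (λ odd → from IsP⇔ (to (parity-*-odd i d) (Odd⇒parity-odd _ (subst Odd value odd))))
  where
  open ≡-Reasoning

  d : ℕ
  d = part (staircaseParts r c k) i ∸ j

  IsP⇔ = IsP⇔OddPair (staircase r c k) (staircase-Paired c k 2∣r) i j
           (position _ ne) (⟶-wellFounded _) refl

  h≡ : part (staircaseParts r c k) i ≡ (k ∸ i / r) ℕ.* c
  h≡ = staircase-part r c k i

  j<h : j < part (staircaseParts r c k) i
  j<h = [,]-nonempty⁻¹ (staircase r c k) i j ne

  i/r≤k : i / r ≤ k
  -- If `k ∸ i / r` were 0, row `i` would have length 0, leaving no room for `j` below it.
  i/r≤k = <⇒≤ (m∸n≢0⇒n<m λ k∸q≡0 →
    n≮0 (subst (j <_) (trans h≡ (cong (ℕ._* c) k∸q≡0)) j<h))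

  -- Nonemptiness makes both integer differences nonnegative, so they agree with the truncated ones
  -- used in the game analysis.
  value : + i * (+ c * (+ k - + (i / r)) - + j) ≡ + (i ℕ.* d)
  value = begin
    + i * (+ c * (+ k - + (i / r)) - + j)   ≡⟨ cong (λ z → + i * (+ c * z - + j)) (+-∸ i/r≤k) ⟩
    + i * (+ c * + (k ∸ i / r) - + j)       ≡⟨ cong (λ z → + i * (z - + j)) (ℤ.pos-* c _) ⟨
    + i * (+ (c ℕ.* (k ∸ i / r)) - + j)     ≡⟨ cong (λ x → + i * (+ x - + j)) (trans (*-comm c _) (sym h≡)) ⟩
    + i * (+ part (staircaseParts r c k) i - + j) ≡⟨ cong (λ z → + i * z) (+-∸ (<⇒≤ j<h)) ⟩
    + i * + d                               ≡⟨ ℤ.pos-* i d ⟨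
    + (i ℕ.* d)                             ∎
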